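{- For every directed social network $G(V,E,w)$ there exists a set $A \subseteq V$ such that the IE strategy $\mathrm{IE}(A, 2/3)$ has expected revenue $R_{\mathrm{IE}}(A, 2/3) \geq 0.55289 \cdot R_{\max}(G)$, where $R_{\max}(G)$ is the maximum revenue of $G$.
   Context: A directed social network $G(V,E,w)$ on a finite set $V$ of $n$ buyers has real weights $w_{ij} \geq 0$ for ordered pairs of distinct buyers $i, j$, with $w_{ij}>0$ exactly when $(i,j)\in E$ (not necessarily symmetric); for directed networks there are no loops, i.e., $w_{ii}=0$ for all $i$. Marketing strategies (Uniform Additive Model). A marketing strategy $(\vec{\pi},\vec{p})$ consists of a permutation $\vec{\pi}$ of $V$ ($\pi_i$ is the position of buyer $i$) and a vector $\vec{p} = (p_i)_{i \in V}$ of pricing probabilities $p_i \in [1/2,1]$. Its expected revenue is $$R(\vec{\pi},\vec{p}) = \sum_{i\in V} p_i(1-p_i)\sum_{j:\pi_j<\pi_i} p_j w_{ji}.$$ The maximum revenue of $G$ is $R_{\max}(G) = \max_{(\vec{\pi},\vec{p})} R(\vec{\pi},\vec{p})$. Influence-and-Exploit (IE) strategies. For $A \subseteq V$ and $p \in [1/2,1)$, $\mathrm{IE}(A,p)$ first gives the product for free to the buyers in $A$ (pricing probability $1$) and then approaches the buyers in $V\setminus A$ in a uniformly random order with pricing probability $p$. Its expected revenue (over the random order) is $$R_{\mathrm{IE}}(A,p) = p(1-p)\sum_{i\in V\setminus A}\Big(\sum_{j\in A} w_{ji} + \sum_{j\in V\setminus A,\ j\neq i} \frac{p\,w_{ji}}{2}\Big).$$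 -}

module Defs where

open import Algebra.Bundles using (CommutativeRing)
open import Algebra.Core using (Op₁; Op₂)
open import Algebra.Structures using (IsCommutativeRing)
import Algebra.Definitions.RawMonoid as RawMonoidDefinitions
import Algebra.Properties.Monoid.Sum as MonoidSum
open import Data.Bool.Base using (if_then_else_)
import Data.Fin.Base as Fin
open import Data.Fin.Base using (Fin)
import Data.Fin.Properties as Fin
open import Data.Fin.Permutation using (Permutation′; _⟨$⟩ʳ_)
open import Data.Fin.Subset using (Subset)
open import Data.Fin.Subset.Properties using (_∈?_)
open import Data.Nat.Base using (ℕ)
open import Data.Product.Base using (_×_; ∃)
open import Function.Bundles using (_⇔_)
open import Level using (suc; _⊔_)
open import Relation.Binary.Core using (Rel)
import Relation.Binary.Construct.NonStrictToStrict as NonStrictToStrict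
open import Relation.Binary.Structures using (IsTotalOrder)
open import Relation.Nullary.Decidable.Core using (Dec; does; ¬?; _×-dec_)
open import Relation.Nullary.Negation.Core using (¬_)
open import Relation.Unary using (Pred; Satisfiable)

-- The real numbers, given by their classical axioms: a complete
-- ordered field is unique up to isomorphism.

record CompleteOrderedField c ℓ₁ ℓ₂ : Set (suc (c ⊔ ℓ₁ ⊔ ℓ₂)) where
  infix  4 _≈_ _≤_
  infixl 6 _+_
  infixl 7 _*_
  infix  8 -_
  infix  9 _⁻¹
  field
    Carrier           : Set c
    _≈_               : Rel Carrier ℓ₁
    _≤_               : Rel Carrier ℓ₂
    _+_ _*_           : Op₂ Carrier
    -_                : Op₁ Carrier
    0# 1#             : Carrier
    _⁻¹               : Op₁ Carrier
    isCommutativeRing : IsCommutativeRing _≈_ _+_ _*_ -_ 0# 1#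
    0≉1               : ¬ 0# ≈ 1#
    ⁻¹-cong           : ∀ {x y} → x ≈ y → x ⁻¹ ≈ y ⁻¹
    -- _⁻¹ is total, with an unspecified value at 0#.
    ⁻¹-inverseʳ       : ∀ x → ¬ x ≈ 0# → x * x ⁻¹ ≈ 1#
    isTotalOrder      : IsTotalOrder _≈_ _≤_
    +-monoʳ-≤         : ∀ x {y z} → y ≤ z → x + y ≤ x + z
    *-nonNegative     : ∀ {x y} → 0# ≤ x → 0# ≤ y → 0# ≤ x * y

  IsUpperBound : ∀ {ℓ} → Pred Carrier ℓ → Pred Carrier (c ⊔ ℓ₂ ⊔ ℓ)
  IsUpperBound S u = ∀ x → S x → x ≤ u

  IsSupremum : ∀ {ℓ} → Pred Carrier ℓ → Pred Carrier (c ⊔ ℓ₂ ⊔ ℓ)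
  IsSupremum S s = IsUpperBound S s × (∀ u → IsUpperBound S u → s ≤ u)

  field
    complete : (S : Pred Carrier (c ⊔ ℓ₁ ⊔ ℓ₂)) →
               Satisfiable S → Satisfiable (IsUpperBound S) →
               ∃ (IsSupremum S)

  commutativeRing : CommutativeRing c ℓ₁
  commutativeRing = record { isCommutativeRing = isCommutativeRing }

  open CommutativeRing commutativeRing public
    using (_-_; rawRing; +-rawMonoid; +-monoid; +-commutativeMonoid; setoid)

  open NonStrictToStrict _≈_ _≤_ public using (_<_)

  open RawMonoidDefinitions +-rawMonoid using () renaming (_×_ to _·_)

  infixl 7 _/_
  _/_ : ℕ → ℕ → Carrier
  m / n = (m · 1#) * (n · 1#) ⁻¹

module _ {c ℓ₁ ℓ₂} (ℝ : CompleteOrderedField c ℓ₁ ℓ₂) where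
  open CompleteOrderedField ℝ
  open MonoidSum +-monoid using (sum)

  record DirectedNetwork (n : ℕ) : Set (c ⊔ suc (ℓ₁ ⊔ ℓ₂)) where
    field
      E     : Rel (Fin n) (ℓ₁ ⊔ ℓ₂)
      w     : Fin n → Fin n → Carrier
      w≥0   : ∀ i j → 0# ≤ w i j
      w>0⇔E : ∀ i j → (0# < w i j) ⇔ E i j
      wᵢᵢ≈0 : ∀ i → w i i ≈ 0#

  record MarketingStrategy (n : ℕ) : Set (c ⊔ ℓ₂) where
    field
      π   : Permutation′ n
      p   : Fin n → Carrier
      p≥½ : ∀ i → 1 / 2 ≤ p i
      p≤1 : ∀ i → p i ≤ 1#

    position : Fin n → Fin n
    position i = π ⟨$⟩ʳ i

  sumOver : ∀ {n ℓ} {P : Pred (Fin n) ℓ} →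
            (∀ i → Dec (P i)) → (Fin n → Carrier) → Carrier
  sumOver P? f = sum λ i → if does (P? i) then f i else 0#

  module _ {n : ℕ} (G : DirectedNetwork n) where
    open DirectedNetwork G

    revenue : MarketingStrategy n → Carrier
    revenue s = sum λ i →
      p i * (1# - p i) *
        sumOver (λ j → position j Fin.<? position i) (λ j → p j * w j i)
      where open MarketingStrategy s

    IsMaximumRevenue : Pred Carrier (c ⊔ ℓ₁ ⊔ ℓ₂)
    IsMaximumRevenue M =
      (∃ λ s → revenue s ≈ M) × (∀ s → revenue s ≤ M)

    -- The expectation over the uniformly random order of V ∖ A: each of
    -- two distinct buyers outside A precedes the other with probability ½.
    revenueIE : Subset n → Carrier → Carrier
    revenueIE A p = p * (1# - p) *
      sumOver (λ i → ¬? (i ∈? A)) λ i →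
        sumOver (λ j → j ∈? A) (λ j → w j i) +
        sumOver (λ j → ¬? (j ∈? A) ×-dec ¬? (j Fin.≟ i))
                (λ j → p * w j i * (1 / 2))

{-# OPTIONS --safe #-}
-- Put each buyer i into A independently with probability pᵢ − ½, where
-- (π , p) is optimal.  A buyer is then outside A with probability 3/2 − pᵢ,
-- and j contributes in expectation (pⱼ − ½) + (3/2 − pⱼ)/3 = (2/3) pⱼ to the
-- weight felt by i, so the expected revenue of IE(A, 2/3) is exactly
-- Σᵢⱼ (4/27) (3/2 − pᵢ) pⱼ wⱼᵢ.  Since (4/27) (3/2 − y) ≥ 0.55289 y (1 − y) for
-- every y (the best constant is 4 (2 + √3) / 27), this dominates
-- 0.55289 R(π , p) buyer by buyer, and some A does as well as the average.
module Submission where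

open import Defs
open import Algebra.Bundles using (CommutativeRing)
open import Data.Bool.Base using (Bool; true; false; if_then_else_; not; _∧_)
import Data.Fin.Base as Fin
import Data.Fin.Properties as Fin
open import Data.Fin.Base using (Fin)
open import Data.Fin.Subset using (Subset; inside; outside)
open import Data.Fin.Subset.Properties using (_∈?_)
open import Data.Nat.Base as ℕ using (ℕ; NonZero)
import Data.Nat.Properties as ℕ
open import Data.Product.Base using (∃; _,_; map₂)
open import Data.Sum.Base using (inj₁; inj₂)
open import Data.Unit.Base using (tt)
open import Data.Vec.Base using ([]; _∷_)
open import Function.Base using (_∘_)
open import Relation.Binary.Bundles using (Poset)
open import Relation.Binary.PropositionalEquality.Core as ≡ using (_≡_; _≢_)
open import Relation.Binary.Structures using (IsTotalOrder)
open import Relation.Nullary.Decidable.Core using (Dec; does; yes; no)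
open import Relation.Nullary.Negation.Core using (¬_; contradiction)

-- Arithmetic of ordered fields.

module OrderedField {c ℓ₁ ℓ₂} (ℝ : CompleteOrderedField c ℓ₁ ℓ₂) where
  open CompleteOrderedField ℝ
  open CommutativeRing commutativeRing public
    using ( commutativeSemiring; semiring; ring
          ; refl; sym; trans; +-cong; +-congˡ; +-congʳ; *-cong; *-congˡ; *-congʳ
          ; +-assoc; +-comm; *-assoc; *-comm; +-identityˡ; +-identityʳ
          ; *-identityˡ; *-identityʳ; zeroʳ; distribˡ; distribʳ; -‿cong
          ; -‿inverseˡ; -‿inverseʳ )
  open IsTotalOrder isTotalOrder public
    using (total; antisym; isPartialOrder; ≤-respˡ-≈; ≤-respʳ-≈)
    renaming (refl to ≤-refl; trans to ≤-trans; reflexive to ≤-reflexive)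
  open import Algebra.Properties.Ring ring
    using (-‿distribˡ-*; -‿involutive; +-cancelʳ) public
  open import Algebra.Properties.Semiring.Mult semiring
    using (×-homo-+; ×1-homo-*) renaming (_×_ to _·_)
  open import Algebra.Solver.Ring.NaturalCoefficients.Default commutativeSemiring
    using (solve; _:=_; _:+_; _:*_; con; Polynomial)

  poset : Poset c ℓ₁ ℓ₂
  poset = record { isPartialOrder = isPartialOrder }

  open import Relation.Binary.Reasoning.PartialOrder poset

  ι : ℕ → Carrier
  ι n = n · 1#

  -- Evaluates definitionally to ι n, unlike con n.
  lit : ∀ {k} → ℕ → Polynomial k
  lit ℕ.zero    = con 0
  lit (ℕ.suc n) = con 1 :+ lit n

  x+[y-x]≈y : ∀ x y → x + (y - x) ≈ y
  x+[y-x]≈y x y = begin-equality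
    x + (y - x)      ≈⟨ +-congˡ (+-comm y (- x)) ⟩
    x + (- x + y)    ≈⟨ +-assoc x (- x) y ⟨
    (x - x) + y      ≈⟨ +-congʳ (-‿inverseʳ x) ⟩
    0# + y           ≈⟨ +-identityˡ y ⟩
    y                ∎

  +-monoˡ-≤ : ∀ x {y z} → y ≤ z → y + x ≤ z + x
  +-monoˡ-≤ x {y} {z} y≤z = begin
    y + x  ≈⟨ +-comm y x ⟩
    x + y  ≤⟨ +-monoʳ-≤ x y≤z ⟩
    x + z  ≈⟨ +-comm x z ⟩
    z + x  ∎

  +-mono-≤ : ∀ {x y u v} → x ≤ y → u ≤ v → x + u ≤ y + v
  +-mono-≤ {y = y} {u} x≤y u≤v = ≤-trans (+-monoˡ-≤ u x≤y) (+-monoʳ-≤ y u≤v)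

  +-cancelˡ-≤ : ∀ z {x y} → z + x ≤ z + y → x ≤ y
  +-cancelˡ-≤ z {x} {y} z+x≤z+y = begin
    x                ≈⟨ shift x ⟨
    - z + (z + x)    ≤⟨ +-monoʳ-≤ (- z) z+x≤z+y ⟩
    - z + (z + y)    ≈⟨ shift y ⟩
    y                ∎
    where
    shift : ∀ u → - z + (z + u) ≈ u
    shift u = trans (sym (+-assoc (- z) z u)) (trans (+-congʳ (-‿inverseˡ z)) (+-identityˡ u))

  x≤y⇒0≤y-x : ∀ {x y} → x ≤ y → 0# ≤ y - x
  x≤y⇒0≤y-x {x} {y} x≤y = begin
    0#     ≈⟨ -‿inverseʳ x ⟨
    x - x  ≤⟨ +-monoˡ-≤ (- x) x≤y ⟩
    y - x  ∎

  +-nonNegative : ∀ {x y} → 0# ≤ x → 0# ≤ y → 0# ≤ x + y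
  +-nonNegative 0≤x 0≤y = ≤-respˡ-≈ (+-identityˡ 0#) (+-mono-≤ 0≤x 0≤y)

  x≤x+y : ∀ x {y} → 0# ≤ y → x ≤ x + y
  x≤x+y x 0≤y = ≤-respˡ-≈ (+-identityʳ x) (+-monoʳ-≤ x 0≤y)

  *-monoˡ-≤ : ∀ {x y z} → 0# ≤ x → y ≤ z → x * y ≤ x * z
  *-monoˡ-≤ {x} {y} {z} 0≤x y≤z = begin
    x * y                  ≤⟨ x≤x+y _ (*-nonNegative 0≤x (x≤y⇒0≤y-x y≤z)) ⟩
    x * y + x * (z - y)    ≈⟨ distribˡ x y (z - y) ⟨
    x * (y + (z - y))      ≈⟨ *-congˡ (x+[y-x]≈y y z) ⟩
    x * z                  ∎

  *-monoʳ-≤ : ∀ {x y z} → 0# ≤ x → y ≤ z → y * x ≤ z * x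
  *-monoʳ-≤ {x} {y} {z} 0≤x y≤z = begin
    y * x  ≈⟨ *-comm y x ⟩
    x * y  ≤⟨ *-monoˡ-≤ 0≤x y≤z ⟩
    x * z  ≈⟨ *-comm x z ⟩
    z * x  ∎

  *-cancelˡ-≈ : ∀ {x} → ¬ x ≈ 0# → ∀ {y z} → x * y ≈ x * z → y ≈ z
  *-cancelˡ-≈ {x} x≉0 {y} {z} xy≈xz = begin-equality
    y                ≈⟨ shift y ⟨
    x ⁻¹ * (x * y)   ≈⟨ *-congˡ xy≈xz ⟩
    x ⁻¹ * (x * z)   ≈⟨ shift z ⟩
    z                ∎
    where
    shift : ∀ u → x ⁻¹ * (x * u) ≈ u
    shift u = begin-equality
      x ⁻¹ * (x * u)   ≈⟨ *-assoc _ x u ⟨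
      x ⁻¹ * x * u     ≈⟨ *-congʳ (trans (*-comm _ x) (⁻¹-inverseʳ x x≉0)) ⟩
      1# * u           ≈⟨ *-identityˡ u ⟩
      u                ∎

  -- By totality only `z ≤ y` needs work: multiplying it by `x` gives the reverse of the hypothesis,
  -- so the two products are equal and `x` cancels. The sign of `x ⁻¹` never has to be determined.
  *-cancelˡ-≤ : ∀ {x} → 0# ≤ x → ¬ x ≈ 0# → ∀ {y z} → x * y ≤ x * z → y ≤ z
  *-cancelˡ-≤ 0≤x x≉0 {y} {z} xy≤xz with total y z
  ... | inj₁ y≤z = y≤z
  ... | inj₂ z≤y = ≤-reflexive (*-cancelˡ-≈ x≉0 (antisym xy≤xz (*-monoˡ-≤ 0≤x z≤y)))

  0≤1 : 0# ≤ 1#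
  0≤1 with total 0# 1#
  ... | inj₁ 0≤1 = 0≤1
  -- If `1# ≤ 0#`, then `- 1#` is nonnegative, and so is its square, which is `1#`.
  ... | inj₂ 1≤0 = begin
    0#             ≤⟨ *-nonNegative 0≤-1 0≤-1 ⟩
    - 1# * - 1#    ≈⟨ -‿distribˡ-* 1# (- 1#) ⟨
    - (1# * - 1#)  ≈⟨ -‿cong (*-identityˡ (- 1#)) ⟩
    - (- 1#)       ≈⟨ -‿involutive 1# ⟩
    1#             ∎
    where
    0≤-1 : 0# ≤ - 1#
    0≤-1 = ≤-respʳ-≈ (+-identityˡ (- 1#)) (x≤y⇒0≤y-x 1≤0)

  -- Substituting `y = x + d` leaves a surplus of exactly `d * d`, and the identity becomes free of
  -- subtraction, as the semiring solver requires.
  x≤y⇒2xy≤x²+y² : ∀ {x y} → x ≤ y → ι 2 * (x * y) ≤ x * x + y * y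
  x≤y⇒2xy≤x²+y² {x} {y} x≤y = begin
    ι 2 * (x * y)                  ≈⟨ *-congˡ (*-congˡ y≈) ⟨
    ι 2 * (x * (x + d))            ≤⟨ x≤x+y _ (*-nonNegative 0≤d 0≤d) ⟩
    ι 2 * (x * (x + d)) + d * d    ≈⟨ solve 2 (λ x d →
                                        lit 2 :* (x :* (x :+ d)) :+ d :* d
                                        := x :* x :+ (x :+ d) :* (x :+ d)) refl x d ⟩
    x * x + (x + d) * (x + d)      ≈⟨ +-congˡ (*-cong y≈ y≈) ⟩
    x * x + y * y                  ∎
    where
    d   = y - x
    y≈  = x+[y-x]≈y x y
    0≤d = x≤y⇒0≤y-x x≤y

  2xy≤x²+y² : ∀ x y → ι 2 * (x * y) ≤ x * x + y * y
  2xy≤x²+y² x y with total x y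
  ... | inj₁ x≤y = x≤y⇒2xy≤x²+y² x≤y
  ... | inj₂ y≤x = begin
    ι 2 * (x * y)    ≈⟨ *-congˡ (*-comm x y) ⟩
    ι 2 * (y * x)    ≤⟨ x≤y⇒2xy≤x²+y² y≤x ⟩
    y * y + x * x    ≈⟨ +-comm _ _ ⟩
    x * x + y * y    ∎

  -- Natural numbers and fractions in the field.

  ι-nonNegative : ∀ n → 0# ≤ ι n
  ι-nonNegative ℕ.zero    = ≤-refl
  ι-nonNegative (ℕ.suc n) = +-nonNegative 0≤1 (ι-nonNegative n)

  ι-mono-≤ : ∀ {m n} → m ℕ.≤ n → ι m ≤ ι n
  ι-mono-≤ {n = n} ℕ.z≤n   = ι-nonNegative n
  ι-mono-≤ (ℕ.s≤s m≤n) = +-monoʳ-≤ 1# (ι-mono-≤ m≤n)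

  ι≉0 : ∀ n .{{_ : NonZero n}} → ¬ ι n ≈ 0#
  ι≉0 (ℕ.suc n) ι≈0 = 0≉1 (antisym 0≤1 (begin
    1#          ≤⟨ x≤x+y 1# (ι-nonNegative n) ⟩
    ι (ℕ.suc n) ≈⟨ ι≈0 ⟩
    0#          ∎))

  ι-*-/ : ∀ m n .{{_ : NonZero n}} → ι n * (m / n) ≈ ι m
  ι-*-/ m n = begin-equality
    ι n * (ι m * ι n ⁻¹)  ≈⟨ solve 3 (λ x y z → x :* (y :* z) := y :* (x :* z))
                               refl (ι n) (ι m) (ι n ⁻¹) ⟩
    ι m * (ι n * ι n ⁻¹)  ≈⟨ *-congˡ (⁻¹-inverseʳ (ι n) (ι≉0 n)) ⟩
    ι m * 1#              ≈⟨ *-identityʳ (ι m) ⟩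
    ι m                   ∎

  /-nonNegative : ∀ m n .{{_ : NonZero n}} → 0# ≤ m / n
  /-nonNegative m n = *-cancelˡ-≤ (ι-nonNegative n) (ι≉0 n) (begin
    ι n * 0#       ≈⟨ zeroʳ (ι n) ⟩
    0#             ≤⟨ ι-nonNegative m ⟩
    ι m            ≈⟨ ι-*-/ m n ⟨
    ι n * (m / n)  ∎)

  x-y+y≈x : ∀ x y → x - y + y ≈ x
  x-y+y≈x x y = trans (+-comm _ y) (x+[y-x]≈y y x)

  -- The hypothesis (M + 4N)² ≤ 24MN says that the discriminant of
  -- M y² − (M + 4N) y + 6N in y is nonpositive.
  quadratic-bound : ∀ {M N y y′ r} → 0# ≤ M → ¬ ι 4 * M ≈ 0# →
    (M + ι 4 * N) * (M + ι 4 * N) ≤ ι 24 * (M * N) →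
    y′ + y ≈ 1# → ι 2 * r + ι 2 * y ≈ ι 3 →
    M * (y * y′) ≤ ι 4 * (N * r)
  quadratic-bound {M} {N} {y} {y′} {r} 0≤M 4M≉0 disc y′+y≈1 2r+2y≈3 =
    -- With `y′ = 1 − y` and `r = 3/2 − y`, adding this term to both sides removes every
    -- subtraction: the claim becomes `(M + 4N) y ≤ M y² + 6N`.
    +-cancelˡ-≤ (M * (y * y) + ι 4 * (N * y)) (begin
      M * (y * y) + ι 4 * (N * y) + M * (y * y′)
        ≈⟨ solve 4 (λ M N y y′ →
             M :* (y :* y) :+ lit 4 :* (N :* y) :+ M :* (y :* y′)
             := M :* y :* (y′ :+ y) :+ lit 4 :* N :* y) refl M N y y′ ⟩
      M * y * (y′ + y) + ι 4 * N * y
        ≈⟨ +-congʳ (*-congˡ y′+y≈1) ⟩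
      M * y * 1# + ι 4 * N * y
        ≈⟨ solve 3 (λ M N y → M :* y :* con 1 :+ lit 4 :* N :* y
             := (M :+ lit 4 :* N) :* y) refl M N y ⟩
      (M + ι 4 * N) * y
        ≤⟨ *-cancelˡ-≤ (*-nonNegative (ι-nonNegative 4) 0≤M) 4M≉0 scaled ⟩
      M * (y * y) + ι 6 * N
        ≈⟨ solve 3 (λ M N y → M :* (y :* y) :+ lit 6 :* N
             := M :* (y :* y) :+ lit 2 :* N :* lit 3) refl M N y ⟩
      M * (y * y) + ι 2 * N * ι 3
        ≈⟨ +-congˡ (*-congˡ 2r+2y≈3) ⟨
      M * (y * y) + ι 2 * N * (ι 2 * r + ι 2 * y)
        ≈⟨ solve 4 (λ M N y r →
             M :* (y :* y) :+ lit 2 :* N :* (lit 2 :* r :+ lit 2 :* y)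
             := M :* (y :* y) :+ lit 4 :* (N :* y) :+ lit 4 :* (N :* r)) refl M N y r ⟩
      M * (y * y) + ι 4 * (N * y) + ι 4 * (N * r) ∎)
    where
    b = M + ι 4 * N
    a = ι 2 * (M * y)

    -- Completing the square: after scaling by `4M` the left side is `2ab`, which is at most
    -- `a² + b²`; the discriminant hypothesis then replaces `b²` by `24MN`.
    scaled : ι 4 * M * (b * y) ≤ ι 4 * M * (M * (y * y) + ι 6 * N)
    scaled = begin
      ι 4 * M * (b * y)
        ≈⟨ solve 3 (λ M y b → lit 4 :* M :* (b :* y)
             := lit 2 :* (lit 2 :* (M :* y) :* b)) refl M y b ⟩
      ι 2 * (a * b)
        ≤⟨ 2xy≤x²+y² a b ⟩
      a * a + b * b
        ≤⟨ +-monoʳ-≤ (a * a) disc ⟩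
      a * a + ι 24 * (M * N)
        ≈⟨ solve 3 (λ M N y →
             lit 2 :* (M :* y) :* (lit 2 :* (M :* y)) :+ lit 24 :* (M :* N)
             := lit 4 :* M :* (M :* (y :* y) :+ lit 6 :* N)) refl M N y ⟩
      ι 4 * M * (M * (y * y) + ι 6 * N) ∎

-- Expectation over independent random subsets.

module Expectation {c ℓ₁ ℓ₂} (ℝ : CompleteOrderedField c ℓ₁ ℓ₂) where
  open CompleteOrderedField ℝ
  open OrderedField ℝ
  open import Algebra.Properties.Semiring.Sum semiring
    using (sum)
  open import Algebra.Solver.Ring.NaturalCoefficients.Default commutativeSemiring
    using (solve; _:=_; _:+_; _:*_)
  open import Relation.Binary.Reasoning.PartialOrder poset

  mean : Carrier → Carrier → Carrier → Carrier
  mean q x y = q * x + (1# - q) * y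

  mean-cong : ∀ q {x x′ y y′} → x ≈ x′ → y ≈ y′ → mean q x y ≈ mean q x′ y′
  mean-cong q x≈x′ y≈y′ = +-cong (*-congˡ x≈x′) (*-congˡ y≈y′)

  mean-idem : ∀ q x → mean q x x ≈ x
  mean-idem q x = begin-equality
    q * x + (1# - q) * x   ≈⟨ distribʳ x q (1# - q) ⟨
    (q + (1# - q)) * x     ≈⟨ *-congʳ (x+[y-x]≈y q 1#) ⟩
    1# * x                 ≈⟨ *-identityˡ x ⟩
    x                      ∎

  mean-+ : ∀ q x x′ y y′ → mean q (x + x′) (y + y′) ≈ mean q x y + mean q x′ y′
  mean-+ q x x′ y y′ =
    solve 6 (λ q r x x′ y y′ → q :* (x :+ x′) :+ r :* (y :+ y′)
      := (q :* x :+ r :* y) :+ (q :* x′ :+ r :* y′)) refl q (1# - q) x x′ y y′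

  mean-*ˡ : ∀ q k x y → mean q (k * x) (k * y) ≈ k * mean q x y
  mean-*ˡ q k x y =
    solve 5 (λ q r k x y → q :* (k :* x) :+ r :* (k :* y)
      := k :* (q :* x :+ r :* y)) refl q (1# - q) k x y

  mean-*ʳ : ∀ q k x y → mean q (x * k) (y * k) ≈ mean q x y * k
  mean-*ʳ q k x y =
    solve 5 (λ q r k x y → q :* (x :* k) :+ r :* (y :* k)
      := (q :* x :+ r :* y) :* k) refl q (1# - q) k x y

  mean-≤ : ∀ {q} → 0# ≤ q → q ≤ 1# → ∀ {x y z} → x ≤ z → y ≤ z → mean q x y ≤ z
  mean-≤ {q} 0≤q q≤1 {x} {y} {z} x≤z y≤z = begin
    mean q x y  ≤⟨ +-mono-≤ (*-monoˡ-≤ 0≤q x≤z) (*-monoˡ-≤ (x≤y⇒0≤y-x q≤1) y≤z) ⟩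
    mean q z z  ≈⟨ mean-idem q z ⟩
    z           ∎

  -- The mean over a random subset containing each i independently with
  -- probability q i.
  𝔼 : ∀ {n} → (Fin n → Carrier) → (Subset n → Carrier) → Carrier
  𝔼 {ℕ.zero}  q f = f []
  𝔼 {ℕ.suc n} q f =
    mean (q Fin.zero) (𝔼 (q ∘ Fin.suc) (λ A → f (inside ∷ A)))
                      (𝔼 (q ∘ Fin.suc) (λ A → f (outside ∷ A)))

  𝔼-cong : ∀ {n} q {f g : Subset n → Carrier} → (∀ A → f A ≈ g A) → 𝔼 q f ≈ 𝔼 q g
  𝔼-cong {ℕ.zero}  q f≈g = f≈g []
  𝔼-cong {ℕ.suc n} q f≈g =
    mean-cong (q Fin.zero) (𝔼-cong (q ∘ Fin.suc) (f≈g ∘ (inside ∷_)))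
      (𝔼-cong (q ∘ Fin.suc) (f≈g ∘ (outside ∷_)))

  𝔼-const : ∀ {n} (q : Fin n → Carrier) x → 𝔼 q (λ _ → x) ≈ x
  𝔼-const {ℕ.zero}  q x = refl
  𝔼-const {ℕ.suc n} q x =
    trans (mean-cong (q Fin.zero) (𝔼-const (q ∘ Fin.suc) x) (𝔼-const (q ∘ Fin.suc) x))
      (mean-idem _ x)

  𝔼-+ : ∀ {n} q (f g : Subset n → Carrier) → 𝔼 q (λ A → f A + g A) ≈ 𝔼 q f + 𝔼 q g
  𝔼-+ {ℕ.zero}  q f g = refl
  𝔼-+ {ℕ.suc n} q f g =
    trans (mean-cong (q Fin.zero) (𝔼-+ (q ∘ Fin.suc) _ _) (𝔼-+ (q ∘ Fin.suc) _ _))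
      (mean-+ (q Fin.zero) _ _ _ _)

  𝔼-sum : ∀ {n m} q (f : Fin m → Subset n → Carrier) →
          𝔼 q (λ A → sum λ i → f i A) ≈ sum λ i → 𝔼 q (f i)
  𝔼-sum {m = ℕ.zero}  q f = 𝔼-const q 0#
  𝔼-sum {m = ℕ.suc m} q f = trans (𝔼-+ q _ _) (+-congˡ (𝔼-sum q (f ∘ Fin.suc)))

  𝔼-*ˡ : ∀ {n} q k (f : Subset n → Carrier) → 𝔼 q (λ A → k * f A) ≈ k * 𝔼 q f
  𝔼-*ˡ {ℕ.zero}  q k f = refl
  𝔼-*ˡ {ℕ.suc n} q k f =
    trans (mean-cong (q Fin.zero) (𝔼-*ˡ (q ∘ Fin.suc) k _) (𝔼-*ˡ (q ∘ Fin.suc) k _))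
      (mean-*ˡ (q Fin.zero) k _ _)

  bernoulli : Carrier → (Bool → Carrier) → Carrier
  bernoulli q φ = mean q (φ true) (φ false)

  -- Coordinates other than `i` average a constant and drop out. An arbitrary `φ` on the membership
  -- bit covers both factors of an edge's contribution at once.
  𝔼-marginal : ∀ {n} q i (φ : Bool → Carrier) →
               𝔼 {n} q (λ A → φ (does (i ∈? A))) ≈ bernoulli (q i) φ
  𝔼-marginal q Fin.zero    φ = mean-cong (q Fin.zero) (𝔼-const (q ∘ Fin.suc) _)
    (𝔼-const (q ∘ Fin.suc) _)
  𝔼-marginal q (Fin.suc i) φ =
    trans (mean-cong (q Fin.zero) (𝔼-marginal (q ∘ Fin.suc) i φ) (𝔼-marginal (q ∘ Fin.suc) i φ))
      (mean-idem (q Fin.zero) _)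

  -- Common leading coordinates are averaged away until one of the two indices is the first.
  -- Conditioning on that coordinate makes its factor a constant, which leaves the inner
  -- expectation, and the other factor is then a marginal.
  𝔼-independent : ∀ {n} q {i j} → i ≢ j → (φ ψ : Bool → Carrier) →
                  𝔼 {n} q (λ A → φ (does (i ∈? A)) * ψ (does (j ∈? A)))
                    ≈ bernoulli (q i) φ * bernoulli (q j) ψ
  𝔼-independent q {Fin.zero}  {Fin.zero}  i≢j φ ψ = contradiction ≡.refl i≢j
  𝔼-independent q {Fin.zero}  {Fin.suc j} i≢j φ ψ =
    trans (mean-cong (q Fin.zero) (conditional true) (conditional false))
      (mean-*ʳ (q Fin.zero) _ _ _)
    where
    conditional : ∀ b → 𝔼 (q ∘ Fin.suc) (λ A → φ b * ψ (does (j ∈? A)))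
                          ≈ φ b * bernoulli (q (Fin.suc j)) ψ
    conditional b = trans (𝔼-*ˡ (q ∘ Fin.suc) (φ b) _) (*-congˡ (𝔼-marginal (q ∘ Fin.suc) j ψ))
  𝔼-independent q {Fin.suc i} {Fin.zero}  i≢j φ ψ =
    trans (𝔼-cong q λ A → *-comm (φ (does (Fin.suc i ∈? A))) (ψ (does (Fin.zero ∈? A))))
      (trans (𝔼-independent q (i≢j ∘ ≡.sym) ψ φ) (*-comm _ _))
  𝔼-independent q {Fin.suc i} {Fin.suc j} i≢j φ ψ =
    trans (mean-cong (q Fin.zero) rest rest) (mean-idem (q Fin.zero) _)
    where
    rest = 𝔼-independent (q ∘ Fin.suc) (i≢j ∘ ≡.cong Fin.suc) φ ψ

  -- A mean never exceeds the larger of its two values, so the coordinates can be fixed one at a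
  -- time by keeping the better of the two branches.
  𝔼-attained : ∀ {n} {q : Fin n → Carrier} → (∀ i → 0# ≤ q i) → (∀ i → q i ≤ 1#) →
               (f : Subset n → Carrier) → ∃ λ A → 𝔼 q f ≤ f A
  𝔼-attained {ℕ.zero}  0≤q q≤1 f = [] , ≤-refl
  𝔼-attained {ℕ.suc n} 0≤q q≤1 f
    with 𝔼-attained (0≤q ∘ Fin.suc) (q≤1 ∘ Fin.suc) (λ A → f (inside ∷ A))
       | 𝔼-attained (0≤q ∘ Fin.suc) (q≤1 ∘ Fin.suc) (λ A → f (outside ∷ A))
  ... | A , 𝔼≤fA | B , 𝔼≤fB with total (f (inside ∷ A)) (f (outside ∷ B))
  ... | inj₁ fA≤fB =
    outside ∷ B , mean-≤ (0≤q Fin.zero) (q≤1 Fin.zero) (≤-trans 𝔼≤fA fA≤fB) 𝔼≤fB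
  ... | inj₂ fB≤fA =
    inside ∷ A , mean-≤ (0≤q Fin.zero) (q≤1 Fin.zero) 𝔼≤fA (≤-trans 𝔼≤fB fB≤fA)

  -- Order properties of finite sums.

  sum-mono-≤ : ∀ {n} {f g : Fin n → Carrier} → (∀ i → f i ≤ g i) → sum f ≤ sum g
  sum-mono-≤ {ℕ.zero}  f≤g = ≤-refl
  sum-mono-≤ {ℕ.suc n} f≤g = +-mono-≤ (f≤g Fin.zero) (sum-mono-≤ (f≤g ∘ Fin.suc))

  sum-nonNegative : ∀ {n} {f : Fin n → Carrier} → (∀ i → 0# ≤ f i) → 0# ≤ sum f
  sum-nonNegative {ℕ.zero}  0≤f = ≤-refl
  sum-nonNegative {ℕ.suc n} 0≤f = +-nonNegative (0≤f Fin.zero) (sum-nonNegative (0≤f ∘ Fin.suc))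

-- Rounding a marketing strategy to a random influence set.

module Rounding {c ℓ₁ ℓ₂} (ℝ : CompleteOrderedField c ℓ₁ ℓ₂) where
  open CompleteOrderedField ℝ
  open OrderedField ℝ
  open Expectation ℝ
  open import Algebra.Properties.Semiring.Mult semiring
    using (×-homo-+; ×1-homo-*)
  open import Algebra.Properties.Semiring.Sum semiring
    using (sum; sum-cong-≋; sum-replicate-zero; ∑-distrib-+; *-distribˡ-sum)
  open import Algebra.Solver.Ring.NaturalCoefficients.Default commutativeSemiring
    using (solve; _:=_; _:+_; _:*_; con)
  open import Relation.Binary.Reasoning.PartialOrder poset

  θ θ′ h K : Carrier
  θ  = 2 / 3
  θ′ = 1# - θ
  h  = 1 / 2
  K  = θ * θ′

  2h≈1 : ι 2 * h ≈ 1#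
  2h≈1 = trans (ι-*-/ 1 2) (+-identityʳ 1#)

  3θ≈2 : ι 3 * θ ≈ ι 2
  3θ≈2 = ι-*-/ 2 3

  3θ′≈1 : ι 3 * θ′ ≈ 1#
  3θ′≈1 = +-cancelʳ (ι 3 * θ) _ _ (begin-equality
    ι 3 * θ′ + ι 3 * θ  ≈⟨ distribˡ (ι 3) θ′ θ ⟨
    ι 3 * (θ′ + θ)      ≈⟨ *-congˡ (x-y+y≈x 1# θ) ⟩
    ι 3 * 1#            ≈⟨ solve 0 (lit 3 :* con 1 := con 1 :+ lit 2) refl ⟩
    1# + ι 2            ≈⟨ +-congˡ 3θ≈2 ⟨
    1# + ι 3 * θ        ∎)

  -- This is the property of the price 2/3 that makes the felt influence proportional to `p`, with
  -- no constant term.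
  θ+θh≈1 : θ + θ * h ≈ 1#
  θ+θh≈1 = begin-equality
    θ + θ * h            ≈⟨ solve 2 (λ θ h → θ :+ θ :* h := θ :* con 1 :+ θ :* h) refl θ h ⟩
    θ * 1# + θ * h       ≈⟨ +-congʳ (*-congˡ 2h≈1) ⟨
    θ * (ι 2 * h) + θ * h ≈⟨ solve 2 (λ θ h → θ :* (lit 2 :* h) :+ θ :* h := lit 3 :* θ :* h)
                               refl θ h ⟩
    ι 3 * θ * h          ≈⟨ *-congʳ 3θ≈2 ⟩
    ι 2 * h              ≈⟨ 2h≈1 ⟩
    1#                   ∎

  0≤K : 0# ≤ K
  0≤K = *-nonNegative (/-nonNegative 2 3)
          (*-cancelˡ-≤ (ι-nonNegative 3) (ι≉0 3)
            (≤-respˡ-≈ (sym (zeroʳ (ι 3))) (≤-respʳ-≈ (sym 3θ′≈1) 0≤1)))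

  -- Both take the bit "belongs to A". `exploited` selects the paying buyers; `felt` is the expected
  -- share of an edge weight passed on by its source: all of it from a buyer in A, otherwise price
  -- times the probability 1/2 of coming first.
  exploited felt : Bool → Carrier
  exploited b = if b then 0# else 1#
  felt      b = if b then 1# else θ * h

  bernoulli-exploited : ∀ q → bernoulli q exploited ≈ 1# - q
  bernoulli-exploited q =
    solve 2 (λ q q′ → q :* con 0 :+ q′ :* con 1 := q′) refl q (1# - q)

  bernoulli-felt : ∀ p → bernoulli (p - h) felt ≈ θ * p
  bernoulli-felt p = begin-equality
    q * 1# + q′ * (θ * h)         ≈⟨ +-congʳ (*-congˡ θ+θh≈1) ⟨
    q * (θ + θ * h) + q′ * (θ * h)
      ≈⟨ solve 4 (λ q q′ θ h → q :* (θ :+ θ :* h) :+ q′ :* (θ :* h)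
           := θ :* q :+ (q :+ q′) :* (θ :* h)) refl q q′ θ h ⟩
    θ * q + (q + q′) * (θ * h)    ≈⟨ +-congˡ (*-congʳ (x+[y-x]≈y q 1#)) ⟩
    θ * q + 1# * (θ * h)
      ≈⟨ solve 3 (λ q θ h → θ :* q :+ con 1 :* (θ :* h) := θ :* (q :+ h)) refl q θ h ⟩
    θ * (q + h)                   ≈⟨ *-congˡ (x-y+y≈x p h) ⟩
    θ * p                         ∎
    where
    q  = p - h
    q′ = 1# - q

  -- The number 27 clears the denominators of θ² (1 − θ) = 4/27.
  exploitation-bound : ∀ m d .{{_ : NonZero m}} .{{_ : NonZero d}} →
    (27 ℕ.* m ℕ.+ 4 ℕ.* d) ℕ.* (27 ℕ.* m ℕ.+ 4 ℕ.* d) ℕ.≤ 24 ℕ.* (27 ℕ.* m ℕ.* d) →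
    ∀ y → m / d * (y * (1# - y)) ≤ K * θ * (1# - (y - h))
  exploitation-bound m d disc y =
    *-cancelˡ-≤ (ι-nonNegative (27 ℕ.* d)) (ι≉0 (27 ℕ.* d) {{ℕ.m*n≢0 27 d}}) (begin
      ι (27 ℕ.* d) * (m / d * (y * y′))
        ≈⟨ *-congʳ (×1-homo-* 27 d) ⟩
      ι 27 * ι d * (m / d * (y * y′))
        ≈⟨ solve 4 (λ a b c x → a :* b :* (c :* x) := a :* (b :* c) :* x) refl
             (ι 27) (ι d) (m / d) (y * y′) ⟩
      ι 27 * (ι d * (m / d)) * (y * y′)
        ≈⟨ *-congʳ (*-congˡ (ι-*-/ m d)) ⟩
      ι 27 * ι m * (y * y′)
        ≈⟨ *-congʳ (×1-homo-* 27 m) ⟨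
      M * (y * y′)
        ≤⟨ quadratic-bound (ι-nonNegative (27 ℕ.* m)) 4M≉0 disc′ (x-y+y≈x 1# y) 2r+2y≈3 ⟩
      ι 4 * (ι d * r)
        -- The 4 is split as `2 · 1 · 2` to match `3θ`, `3θ′` and `3θ`, whose product is `27 θ² θ′`.
        ≈⟨ solve 2 (λ N r → lit 4 :* (N :* r) := lit 2 :* con 1 :* lit 2 :* (N :* r))
             refl (ι d) r ⟩
      ι 2 * 1# * ι 2 * (ι d * r)
        ≈⟨ *-congʳ (*-cong (*-cong 3θ≈2 3θ′≈1) 3θ≈2) ⟨
      ι 3 * θ * (ι 3 * θ′) * (ι 3 * θ) * (ι d * r)
        ≈⟨ solve 4 (λ θ θ′ N r →
             lit 3 :* θ :* (lit 3 :* θ′) :* (lit 3 :* θ) :* (N :* r)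
             := lit 27 :* N :* (θ :* θ′ :* θ :* r)) refl θ θ′ (ι d) r ⟩
      ι 27 * ι d * (K * θ * r)
        ≈⟨ *-congʳ (×1-homo-* 27 d) ⟨
      ι (27 ℕ.* d) * (K * θ * r) ∎)
    where
    M  = ι (27 ℕ.* m)
    N  = ι d
    y′ = 1# - y
    r  = 1# - (y - h)

    4M≉0 : ¬ ι 4 * M ≈ 0#
    4M≉0 4M≈0 = ι≉0 (4 ℕ.* (27 ℕ.* m)) {{ℕ.m*n≢0 4 (27 ℕ.* m) {{_}} {{ℕ.m*n≢0 27 m}}}}
                  (trans (×1-homo-* 4 (27 ℕ.* m)) 4M≈0)

    ι-sum : ι (27 ℕ.* m ℕ.+ 4 ℕ.* d) ≈ M + ι 4 * N
    ι-sum = trans (×-homo-+ 1# (27 ℕ.* m) (4 ℕ.* d)) (+-congˡ (×1-homo-* 4 d))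

    disc′ : (M + ι 4 * N) * (M + ι 4 * N) ≤ ι 24 * (M * N)
    disc′ = begin
      (M + ι 4 * N) * (M + ι 4 * N)
        ≈⟨ *-cong ι-sum ι-sum ⟨
      ι (27 ℕ.* m ℕ.+ 4 ℕ.* d) * ι (27 ℕ.* m ℕ.+ 4 ℕ.* d)
        ≈⟨ ×1-homo-* (27 ℕ.* m ℕ.+ 4 ℕ.* d) (27 ℕ.* m ℕ.+ 4 ℕ.* d) ⟨
      ι ((27 ℕ.* m ℕ.+ 4 ℕ.* d) ℕ.* (27 ℕ.* m ℕ.+ 4 ℕ.* d))
        ≤⟨ ι-mono-≤ disc ⟩
      ι (24 ℕ.* (27 ℕ.* m ℕ.* d))
        ≈⟨ ×1-homo-* 24 (27 ℕ.* m ℕ.* d) ⟩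
      ι 24 * ι (27 ℕ.* m ℕ.* d)
        ≈⟨ *-congˡ (×1-homo-* (27 ℕ.* m) d) ⟩
      ι 24 * (M * N) ∎

    2r+2y≈3 : ι 2 * r + ι 2 * y ≈ ι 3
    2r+2y≈3 = begin-equality
      ι 2 * r + ι 2 * y
        ≈⟨ +-congˡ (*-congˡ (x-y+y≈x y h)) ⟨
      ι 2 * r + ι 2 * ((y - h) + h)
        ≈⟨ solve 3 (λ r q h → lit 2 :* r :+ lit 2 :* (q :+ h)
             := lit 2 :* (r :+ q) :+ lit 2 :* h) refl r (y - h) h ⟩
      ι 2 * (r + (y - h)) + ι 2 * h
        ≈⟨ +-cong (*-congˡ (x-y+y≈x 1# (y - h))) 2h≈1 ⟩
      ι 2 * 1# + 1#
        ≈⟨ solve 0 (lit 2 :* con 1 :+ con 1 := lit 3) refl ⟩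
      ι 3 ∎

  -- Expected revenue of the random IE strategy.

  module _ {n} (G : DirectedNetwork ℝ n) where
    open DirectedNetwork G

    -- The product form does not exclude `j = i`, whereas the IE revenue does; the two agree because
    -- loops have weight zero.
    contribution : ∀ (A : Subset n) i j →
      exploited (does (i ∈? A)) * felt (does (j ∈? A)) * w j i ≈
      (if not (does (i ∈? A))
       then (if does (j ∈? A) then w j i else 0#) +
            (if not (does (j ∈? A)) ∧ not (does (j Fin.≟ i)) then θ * w j i * h else 0#)
       else 0#)
    contribution A i j with does (i ∈? A) | does (j ∈? A) | j Fin.≟ i
    ... | true  | b     | _     =
      solve 2 (λ x w → con 0 :* x :* w := con 0) refl (felt b) (w j i)
    ... | false | true  | _     =
      solve 1 (λ w → con 1 :* con 1 :* w := w :+ con 0) refl (w j i)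
    ... | false | false | no _  =
      solve 3 (λ θ h w → con 1 :* (θ :* h) :* w := con 0 :+ θ :* w :* h) refl θ h (w j i)
    ... | false | false | yes ≡.refl = begin-equality
      1# * (θ * h) * w i i  ≈⟨ *-congˡ (wᵢᵢ≈0 i) ⟩
      1# * (θ * h) * 0#     ≈⟨ zeroʳ _ ⟩
      0#                    ≈⟨ +-identityʳ 0# ⟨
      0# + 0#               ∎

    if-sum : ∀ b (f g : Fin n → Carrier) →
      (if b then sum f + sum g else 0#) ≈ sum (λ j → if b then f j + g j else 0#)
    if-sum true  f g = sym (∑-distrib-+ f g)
    if-sum false f g = sym (sum-replicate-zero n)

    weight : Subset n → Fin n → Fin n → Carrier
    weight A i j = exploited (does (i ∈? A)) * felt (does (j ∈? A))

    -- Each summand becomes a coefficient independent of `A` times a function of the bit of `i` and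
    -- a function of the bit of `j`, the shape to which linearity and independence apply.
    revenueIE-bilinear : ∀ A → revenueIE ℝ G A θ ≈
      sum λ i → sum λ j → K * w j i * weight A i j
    revenueIE-bilinear A = begin-equality
      revenueIE ℝ G A θ
        ≈⟨ *-distribˡ-sum {n} K buyer ⟩
      sum (λ i → K * buyer i)
        ≈⟨ sum-cong-≋ {n} (λ i → trans
             (*-congˡ (if-sum (not (does (i ∈? A))) (given i) (paid i)))
             (*-distribˡ-sum {n} K (edge i))) ⟩
      sum (λ i → sum λ j → K * edge i j)
        ≈⟨ sum-cong-≋ {n} (λ i → sum-cong-≋ {n} λ j → begin-equality
             K * edge i j
               ≈⟨ *-congˡ (contribution A i j) ⟨
             K * (weight A i j * w j i)
               ≈⟨ solve 3 (λ k x w → k :* (x :* w) := k :* w :* x) refl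
                    K (weight A i j) (w j i) ⟩
             K * w j i * weight A i j ∎) ⟩
      sum (λ i → sum λ j → K * w j i * weight A i j) ∎
      where
      given paid edge : Fin n → Fin n → Carrier
      given i j = if does (j ∈? A) then w j i else 0#
      paid  i j = if not (does (j ∈? A)) ∧ not (does (j Fin.≟ i)) then θ * w j i * h else 0#
      edge  i j = if not (does (i ∈? A)) then given i j + paid i j else 0#

      buyer : Fin n → Carrier
      buyer i = if not (does (i ∈? A)) then sum (given i) + sum (paid i) else 0#

    𝔼-weight : ∀ (p : Fin n → Carrier) {i j} → i ≢ j →
      𝔼 (λ i → p i - h) (λ A → weight A i j) ≈ (1# - (p i - h)) * (θ * p j)
    𝔼-weight p {i} {j} i≢j =
      trans (𝔼-independent (λ i → p i - h) i≢j exploited felt)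
        (*-cong (bernoulli-exploited (p i - h)) (bernoulli-felt (p j)))

    𝔼-edge : ∀ (p : Fin n → Carrier) i j →
      𝔼 (λ i → p i - h) (λ A → K * w j i * weight A i j) ≈
      K * θ * (1# - (p i - h)) * (p j * w j i)
    𝔼-edge p i j = trans (𝔼-*ˡ q (K * w j i) (λ A → weight A i j)) (weigh (i Fin.≟ j))
      where
      q : Fin n → Carrier
      q i = p i - h

      weigh : Dec (i ≡ j) →
        K * w j i * 𝔼 q (λ A → weight A i j) ≈ K * θ * (1# - q i) * (p j * w j i)
      weigh (yes ≡.refl) = begin-equality
        K * w i i * 𝔼 q (λ A → weight A i i)
          ≈⟨ *-congʳ (*-congˡ (wᵢᵢ≈0 i)) ⟩
        K * 0# * 𝔼 q (λ A → weight A i i)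
          ≈⟨ solve 4 (λ k e x p → k :* con 0 :* e := x :* (p :* con 0)) refl
               K (𝔼 q (λ A → weight A i i)) (K * θ * (1# - q i)) (p i) ⟩
        K * θ * (1# - q i) * (p i * 0#)
          ≈⟨ *-congˡ (*-congˡ (wᵢᵢ≈0 i)) ⟨
        K * θ * (1# - q i) * (p i * w i i) ∎
      weigh (no i≢j) = begin-equality
        K * w j i * 𝔼 q (λ A → weight A i j)
          ≈⟨ *-congˡ (𝔼-weight p i≢j) ⟩
        K * w j i * ((1# - q i) * (θ * p j))
          ≈⟨ solve 5 (λ k w r θ p → k :* w :* (r :* (θ :* p)) := k :* θ :* r :* (p :* w))
               refl K (w j i) (1# - q i) θ (p j) ⟩
        K * θ * (1# - q i) * (p j * w j i) ∎

    𝔼-revenueIE : ∀ (p : Fin n → Carrier) →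
      𝔼 (λ i → p i - h) (λ A → revenueIE ℝ G A θ) ≈
      sum λ i → K * θ * (1# - (p i - h)) * sum λ j → p j * w j i
    𝔼-revenueIE p = begin-equality
      𝔼 q (λ A → revenueIE ℝ G A θ)
        ≈⟨ 𝔼-cong q revenueIE-bilinear ⟩
      𝔼 q (λ A → sum λ i → sum λ j → K * w j i * weight A i j)
        ≈⟨ 𝔼-sum q (λ i A → sum λ j → K * w j i * weight A i j) ⟩
      sum (λ i → 𝔼 q λ A → sum λ j → K * w j i * weight A i j)
        ≈⟨ sum-cong-≋ {n} (λ i → begin-equality
             𝔼 q (λ A → sum λ j → K * w j i * weight A i j)
               ≈⟨ 𝔼-sum q (λ j A → K * w j i * weight A i j) ⟩
             sum (λ j → 𝔼 q λ A → K * w j i * weight A i j)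
               ≈⟨ sum-cong-≋ {n} (𝔼-edge p i) ⟩
             sum (λ j → K * θ * (1# - q i) * (p j * w j i))
               ≈⟨ *-distribˡ-sum {n} (K * θ * (1# - q i)) (λ j → p j * w j i) ⟨
             K * θ * (1# - q i) * sum (λ j → p j * w j i) ∎) ⟩
      sum (λ i → K * θ * (1# - q i) * sum λ j → p j * w j i) ∎
      where
      q : Fin n → Carrier
      q i = p i - h

    -- Comparison with the revenue of a given strategy.

    module _ (s : MarketingStrategy ℝ n) where
      open MarketingStrategy s

      0≤p : ∀ i → 0# ≤ p i
      0≤p i = ≤-trans (/-nonNegative 1 2) (p≥½ i)

      0≤p-h : ∀ i → 0# ≤ p i - h
      0≤p-h i = x≤y⇒0≤y-x (p≥½ i)

      p-h≤1 : ∀ i → p i - h ≤ 1#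
      p-h≤1 i = begin
        p i - h      ≤⟨ x≤x+y _ (/-nonNegative 1 2) ⟩
        p i - h + h  ≈⟨ x-y+y≈x (p i) h ⟩
        p i          ≤⟨ p≤1 i ⟩
        1#           ∎

      -- The expectation does not depend on the order `π`. For each buyer the inequality loses
      -- twice: in `bound`, and in extending the sum from the preceding buyers to all buyers.
      revenue≤𝔼-revenueIE : ∀ {c} →
        (∀ y → c * (y * (1# - y)) ≤ K * θ * (1# - (y - h))) →
        c * revenue ℝ G s ≤ 𝔼 (λ i → p i - h) (λ A → revenueIE ℝ G A θ)
      revenue≤𝔼-revenueIE {c} bound = begin
        c * revenue ℝ G s
          ≈⟨ *-distribˡ-sum {n} c (λ i → p i * (1# - p i) * sum (before i)) ⟩
        sum (λ i → c * (p i * (1# - p i) * sum (before i)))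
          ≤⟨ sum-mono-≤ buyer ⟩
        sum (λ i → K * θ * (1# - (p i - h)) * sum λ j → p j * w j i)
          ≈⟨ 𝔼-revenueIE p ⟨
        𝔼 (λ i → p i - h) (λ A → revenueIE ℝ G A θ) ∎
        where
        before : Fin n → Fin n → Carrier
        before i j = if does (position j Fin.<? position i) then p j * w j i else 0#

        0≤pw : ∀ i j → 0# ≤ p j * w j i
        0≤pw i j = *-nonNegative (0≤p j) (w≥0 j i)

        0≤before : ∀ i j → 0# ≤ before i j
        0≤before i j with does (position j Fin.<? position i)
        ... | true  = 0≤pw i j
        ... | false = ≤-refl

        before≤pw : ∀ i j → before i j ≤ p j * w j i
        before≤pw i j with does (position j Fin.<? position i)
        ... | true  = ≤-refl
        ... | false = 0≤pw i j

        buyer : ∀ i → c * (p i * (1# - p i) * sum (before i)) ≤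
                      K * θ * (1# - (p i - h)) * sum λ j → p j * w j i
        buyer i = begin
          c * (p i * (1# - p i) * sum (before i))
            ≈⟨ *-assoc c _ _ ⟨
          c * (p i * (1# - p i)) * sum (before i)
            ≤⟨ *-monoʳ-≤ (sum-nonNegative (0≤before i)) (bound (p i)) ⟩
          K * θ * (1# - (p i - h)) * sum (before i)
            -- Enlarging the sum requires a nonnegative coefficient; `1# - (p i - h)` is one, being
            -- the probability that `i` stays outside A.
            ≤⟨ *-monoˡ-≤ (*-nonNegative (*-nonNegative 0≤K (/-nonNegative 2 3))
                            (x≤y⇒0≤y-x (p-h≤1 i)))
                 (sum-mono-≤ (before≤pw i)) ⟩
          K * θ * (1# - (p i - h)) * sum (λ j → p j * w j i) ∎

      IE-approximates : ∀ {c} →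
        (∀ y → c * (y * (1# - y)) ≤ K * θ * (1# - (y - h))) →
        ∃ λ A → c * revenue ℝ G s ≤ revenueIE ℝ G A θ
      IE-approximates {c} bound =
        map₂ (≤-trans (revenue≤𝔼-revenueIE {c} bound))
          (𝔼-attained 0≤p-h p-h≤1 (λ A → revenueIE ℝ G A θ))

    -- The hypothesis on the maximum supplies an optimal strategy to round. Keeping the ratio
    -- `m / d` symbolic confines the numerical content to one inequality between natural numbers.
    IE-approximates-maximum : ∀ m d .{{_ : NonZero m}} .{{_ : NonZero d}} →
      (27 ℕ.* m ℕ.+ 4 ℕ.* d) ℕ.* (27 ℕ.* m ℕ.+ 4 ℕ.* d) ℕ.≤ 24 ℕ.* (27 ℕ.* m ℕ.* d) →
      ∀ {Rmax} → IsMaximumRevenue ℝ G Rmax →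
      ∃ λ A → m / d * Rmax ≤ revenueIE ℝ G A θ
    IE-approximates-maximum m d disc ((s , R≈Rmax) , _) =
      map₂ (≤-respˡ-≈ (*-congˡ R≈Rmax))
        (IE-approximates s {m / d} (exploitation-bound m d disc))

theorem2 : ∀ {c ℓ₁ ℓ₂} (ℝ : CompleteOrderedField c ℓ₁ ℓ₂) →
    let open CompleteOrderedField ℝ in
    ∀ (n : ℕ) (G : DirectedNetwork ℝ n) (Rmax : Carrier) →
    IsMaximumRevenue ℝ G Rmax →
    ∃ λ (A : Subset n) →
    (55289 / 100000) * Rmax ≤ revenueIE ℝ G A (2 / 3)
theorem2 ℝ n G Rmax isMax =
  -- The remaining inequality is `1892803² ≤ 24 · 1492803 · 100000`, where `27 · 55289 = 1492803`;
  -- it is decided by evaluating the Boolean comparison.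
  Rounding.IE-approximates-maximum ℝ G 55289 100000 (ℕ.≤ᵇ⇒≤ _ _ tt) isMax
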